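{- Let $n,g,k,t,u$ be positive integers. If there exist a large set of H-designs LH$(n,g,k,t)$ and an orthogonal array OA$(t,k,u)$, then there exists a large set of H-designs LH$(n,gu,k,t)$.
   Context: An H-design H$(n,g,k,t)$ is a triple $(Q,G,B)$ where $Q$ is a set of $ng$ points, $G$ is a partition of $Q$ into $n$ groups of size $g$, and $B$ is a set of $k$-subsets of $Q$ (blocks) such that each block meets each group in at most one point and any $t$ points from $t$ distinct groups lie in exactly one block. A large set of H-designs LH$(n,g,k,t)$ is a partition of the set of all $k$-subsets of $Q$ meeting each group of $G$ in at most one point into pairwise disjoint block sets, each of which forms (with $Q$ and $G$) an H-design H$(n,g,k,t)$. An orthogonal array OA$(t,k,u)$ is a $u^t\times k$ matrix with entries from $\mathbb{Z}_u$ such that in the submatrix formed by any $t$ columns each ordered $t$-tuple over $\mathbb{Z}_u$ occurs exactly once as a row. -}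

module Defs where

open import Data.Nat.Base using (ℕ; _*_; _^_)
open import Data.Fin.Base using (Fin)
open import Data.Fin.Subset using (Subset; _∈_; _⊆_; ∣_∣)
open import Data.Product using (∃; ∃!; _×_)
open import Data.Vec.Functional using (Vector)
open import Function.Definitions using (Injective)
open import Level using (Level; 0ℓ; _⊔_)
open import Relation.Binary.PropositionalEquality using (_≡_; _≢_)
open import Relation.Unary using (Pred; U; Satisfiable; _⊥_) renaming (_⊆_ to _⊆ᵖ_)

private
  variable
    a i ℓ ℓ′ : Level

record IsPartition {A : Set a} {I : Set i} (X : Pred A ℓ) (P : I → Pred A ℓ′)
                   : Set (a ⊔ i ⊔ ℓ ⊔ ℓ′) where
  field
    nonempty : ∀ j → Satisfiable (P j)
    within   : ∀ j → P j ⊆ᵖ X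
    disjoint : ∀ {j j′} → j ≢ j′ → P j ⊥ P j′
    covers   : ∀ {x} → X x → ∃ λ j → P j x

-- The point set Q of size ng is Fin (n * g).
record IsGrouping {n g : ℕ} (G : Fin n → Subset (n * g)) : Set where
  field
    partition : IsPartition U (λ j x → x ∈ G j)
    groupSize : ∀ j → ∣ G j ∣ ≡ g

-- The m-subsets of the point set that meet each group in at most one point.
-- Equivalently, sets of m points from m distinct groups.
record IsTransversal {n v : ℕ} (G : Fin n → Subset v) (m : ℕ) (S : Subset v) : Set where
  field
    size      : ∣ S ∣ ≡ m
    atMostOne : ∀ j {x y} → x ∈ S → x ∈ G j → y ∈ S → y ∈ G j → x ≡ y

record IsHDesign {n g : ℕ} (k t : ℕ) (G : Fin n → Subset (n * g))
                 (𝓑 : Pred (Subset (n * g)) 0ℓ) : Set where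
  field
    grouping : IsGrouping {n} {g} G
    blocks   : 𝓑 ⊆ᵖ IsTransversal G k
    balanced : ∀ {T} → IsTransversal G t T → ∃! _≡_ λ B → 𝓑 B × T ⊆ B

-- No decidability is asked of the block sets: it follows from `partition`,
-- since being transversal and equality of indices are decidable.
record LargeSet (n g k t : ℕ) : Set₁ where
  field
    G         : Fin n → Subset (n * g)
    grouping  : IsGrouping {n} {g} G
    N         : ℕ
    𝓑         : Fin N → Pred (Subset (n * g)) 0ℓ
    partition : IsPartition (IsTransversal G k) 𝓑
    designs   : ∀ j → IsHDesign {n} {g} k t G (𝓑 j)

-- ℤ_u enters only as a set of u symbols, so entries are taken in Fin u.
record OrthogonalArray (t k u : ℕ) : Set where
  field
    rows     : Vector (Vector (Fin u) k) (u ^ t)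
    balanced : (c : Fin t → Fin k) → Injective _≡_ _≡_ c →
               (w : Vector (Fin u) t) →
               ∃! _≡_ λ r → ∀ j → rows r (c j) ≡ w j

{-# OPTIONS --safe #-}

-- An OA(t, k, u) extends to a partition of all words of length k over ℤ_u into arrays OA(t, k, u):
-- take its translates by the vectors vanishing on the first t coordinates. Now replace each point by u
-- copies and each group by the union of its copies. A transversal of the new groups is a transversal
-- S of the old ones together with a word recording, along the increasing enumeration of S, which copy
-- of each point is taken. Put a k-transversal in class (j, e) if S is a block of the j-th design and the
-- word belongs to the e-th array. A t-transversal lies in a block of class (j, e) exactly when its
-- support T lies in the block B and its word is the restriction of the word of B to the t positions
-- of T in B; the balance of the design determines B, and then that of the array determines the word.

module Submission where

open import Data.Bool.Base using (true)
open import Data.Fin.Base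
  using (Fin; zero; suc; toℕ; cast; combine; remQuot; splitAt; _↑ˡ_; _↑ʳ_; finToFun; funToFin)
open import Data.Fin.Properties
  using (_≟_; any?; toℕ-injective; toℕ-fromℕ<; toℕ<n; cast-involutive; combine-remQuot;
         remQuot-combine; splitAt-↑ˡ; splitAt-↑ʳ; join-splitAt; ↑ˡ-injective; suc-injective;
         funToFin-finToFin; finToFun-funToFin; cantor-schröder-bernstein; injective⇒≤)
open import Data.Fin.Subset using (Subset; _∈_; _⊆_; ∣_∣; inside; outside)
open import Data.Fin.Subset.Properties using (⊆-antisym)
open import Data.Nat.Base using (ℕ; NonZero; _+_; _*_; _^_; _%_; pred)
open import Data.Nat.Divisibility using (_∣_; ∣m+n∣m⇒∣n; n∣m*n; m∣m*n)
open import Data.Nat.DivMod using (_mod_; _/_; m%n<n; m<n⇒m%n≡m; m≡m%n+[m/n]*n; %-remove-+ˡ)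
open import Data.Nat.Properties
  using (+-comm; +-assoc; *-suc; *-comm; *-assoc; _≤?_; m≤n⇒∃[o]m+o≡n; suc-pred; ≡-irrelevant)
open import Data.Product using (∃; ∃₂; ∃!; Σ-syntax; _×_; _,_; proj₁; proj₂; uncurry)
open import Data.Sum.Base using (inj₁; inj₂; [_,_]′)
open import Data.Unit.Base using (⊤; tt)
open import Data.Vec.Base using ([]; _∷_; tabulate; here; there)
open import Data.Vec.Functional using (Vector)
open import Data.Vec.Properties using (lookup∘tabulate; []=⇒lookup; lookup⇒[]=)
open import Function.Base using (_∘_; id)
open import Function.Definitions using (Injective)
open import Level using (0ℓ)
open import Relation.Binary.PropositionalEquality
  using (_≡_; _≗_; refl; sym; trans; cong; cong₂; subst; module ≡-Reasoning)
open import Relation.Nullary using (Dec; yes; no; does; contradiction)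
open import Relation.Nullary.Decidable using (dec-true)
open import Relation.Unary using (Pred; Satisfiable)
open import Defs

private
  variable
    m k t u v : ℕ

-- The Latin square x, y ↦ − (x + y) mod u. It is used instead of addition because it is totally
-- symmetric: each of x, y, z is the Latin product of the other two when x + y + z ≡ 0.

-- Opaque so that the unifier can recover the arguments of latin instead of unfolding mod.
opaque
  latin : .{{_ : NonZero u}} → Fin u → Fin u → Fin u
  latin {u} x y = ((toℕ x + toℕ y) * pred u) mod u

  toℕ-latin : .{{_ : NonZero u}} (x y : Fin u) → toℕ (latin x y) ≡ ((toℕ x + toℕ y) * pred u) % u
  toℕ-latin {u} x y = toℕ-fromℕ< (m%n<n ((toℕ x + toℕ y) * pred u) u)

∣+-unique : .{{_ : NonZero u}} (s : ℕ) {x y : Fin u} → u ∣ s + toℕ x → u ∣ s + toℕ y → x ≡ y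
∣+-unique {u} s {x} {y} u∣s+x u∣s+y = toℕ-injective (begin
  toℕ x                     ≡⟨ m<n⇒m%n≡m (toℕ<n x) ⟨
  toℕ x % u                 ≡⟨ %-remove-+ˡ (toℕ x) u∣s+y ⟨
  (s + toℕ y + toℕ x) % u   ≡⟨ cong (_% u) swap ⟩
  (s + toℕ x + toℕ y) % u   ≡⟨ %-remove-+ˡ (toℕ y) u∣s+x ⟩
  toℕ y % u                 ≡⟨ m<n⇒m%n≡m (toℕ<n y) ⟩
  toℕ y                     ∎)
  where
  open ≡-Reasoning
  swap : s + toℕ y + toℕ x ≡ s + toℕ x + toℕ y
  swap = trans (+-assoc s _ _) (trans (cong (s +_) (+-comm (toℕ y) (toℕ x))) (sym (+-assoc s _ _)))

-- Before reduction the sum is `s + s * pred u`, a multiple of `u`, and reducing the second term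
-- takes away only the multiple `r / u * u`.
∣-latin : .{{_ : NonZero u}} (x y : Fin u) → u ∣ toℕ x + toℕ y + toℕ (latin x y)
∣-latin {u} x y = ∣m+n∣m⇒∣n (subst (u ∣_) (sym total) (m∣m*n s)) (n∣m*n (r / u))
  where
  open ≡-Reasoning
  s = toℕ x + toℕ y
  r = s * pred u
  total : r / u * u + (s + toℕ (latin x y)) ≡ u * s
  total = begin
    r / u * u + (s + toℕ (latin x y))   ≡⟨ cong (λ z → r / u * u + (s + z)) (toℕ-latin x y) ⟩
    r / u * u + (s + r % u)             ≡⟨ +-comm (r / u * u) (s + r % u) ⟩
    s + r % u + r / u * u               ≡⟨ +-assoc s (r % u) (r / u * u) ⟩
    s + (r % u + r / u * u)             ≡⟨ cong (s +_) (m≡m%n+[m/n]*n r u) ⟨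
    s + s * pred u                      ≡⟨ *-suc s (pred u) ⟨
    s * ℕ.suc (pred u)                  ≡⟨ cong (s *_) (suc-pred u) ⟩
    s * u                               ≡⟨ *-comm s u ⟩
    u * s                               ∎

latin-comm : .{{_ : NonZero u}} (x y : Fin u) → latin x y ≡ latin y x
latin-comm {u} x y = toℕ-injective (begin
  toℕ (latin x y)                       ≡⟨ toℕ-latin x y ⟩
  (toℕ x + toℕ y) * pred u % u          ≡⟨ cong (λ s → s * pred u % u) (+-comm (toℕ x) (toℕ y)) ⟩
  (toℕ y + toℕ x) * pred u % u          ≡⟨ toℕ-latin y x ⟨
  toℕ (latin y x)                       ∎)
  where open ≡-Reasoning

-- Both sides complete `toℕ x + toℕ (latin x y)` to a multiple of `u`, so `∣+-unique` identifies
-- them.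
latin-involutive : .{{_ : NonZero u}} (x y : Fin u) → latin x (latin x y) ≡ y
latin-involutive {u} x y = ∣+-unique (toℕ x + toℕ (latin x y)) (∣-latin x (latin x y))
  (subst (u ∣_) swap (∣-latin x y))
  where
  swap : toℕ x + toℕ y + toℕ (latin x y) ≡ toℕ x + toℕ (latin x y) + toℕ y
  swap = trans (+-assoc (toℕ x) _ _)
    (trans (cong (toℕ x +_) (+-comm (toℕ y) _)) (sym (+-assoc (toℕ x) _ _)))

latin-solveʳ : .{{_ : NonZero u}} {x y z : Fin u} → latin x y ≡ z → y ≡ latin x z
latin-solveʳ {x = x} {y} eq = trans (sym (latin-involutive x y)) (cong (latin x) eq)

latin-solveˡ : .{{_ : NonZero u}} {x y z : Fin u} → latin x y ≡ z → x ≡ latin z y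
latin-solveˡ {x = x} {y} {z} eq = trans (latin-solveʳ (trans (latin-comm y x) eq)) (latin-comm y z)

-- Large sets of orthogonal arrays

-- Words are compared pointwise, as function extensionality is not available.
record LargeSetOA (t k u : ℕ) : Set₁ where
  field
    M            : ℕ
    𝓡            : Fin M → Pred (Vector (Fin u) k) 0ℓ
    nonempty     : ∀ e → Satisfiable (𝓡 e)
    covers       : ∀ w → ∃ λ e → 𝓡 e w
    disjoint     : ∀ {e e′ w w′} → 𝓡 e w → 𝓡 e′ w′ → w ≗ w′ → e ≡ e′
    balanced     : ∀ e (c : Fin t → Fin k) → Injective _≡_ _≡_ c → (z : Vector (Fin u) t) →
                   ∃! _≗_ λ w → 𝓡 e w × w ∘ c ≗ z

module Translates {t d u : ℕ} .{{_ : NonZero u}} (OA : OrthogonalArray t (t + d) u) where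
  open OrthogonalArray OA

  0# : Fin u
  0# = 0 mod u

  -- Only the last d coordinates are translated: a word then determines its row from the first t
  -- coordinates and its translation from the others.
  offset : Fin (u ^ d) → Fin (t + d) → Fin u
  offset e i = [ (λ _ → 0#) , finToFun e ]′ (splitAt t i)

  𝓡 : Fin (u ^ d) → Pred (Vector (Fin u) (t + d)) 0ℓ
  𝓡 e w = ∃ λ r → ∀ i → latin (rows r i) (offset e i) ≡ w i

  offset-↑ˡ : ∀ e i → offset e (i ↑ˡ d) ≡ 0#
  offset-↑ˡ e i rewrite splitAt-↑ˡ t i d = refl

  offset-↑ʳ : ∀ e i → offset e (t ↑ʳ i) ≡ finToFun e i
  offset-↑ʳ e i rewrite splitAt-↑ʳ t d i = refl

  row-unique : {c : Fin t → Fin (t + d)} → Injective _≡_ _≡_ c →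
               ∀ {r r′} → (∀ j → rows r (c j) ≡ rows r′ (c j)) → r ≡ r′
  row-unique {c} c-inj {r} {r′} eq with balanced c c-inj (rows r′ ∘ c)
  ... | _ , _ , unique = trans (sym (unique eq)) (unique (λ _ → refl))

  ↑-cases : ∀ {p} {P : Fin (t + d) → Set p} → (∀ i → P (i ↑ˡ d)) → (∀ i → P (t ↑ʳ i)) → ∀ i → P i
  ↑-cases {P = P} l r i with splitAt t i | join-splitAt t d i
  ... | inj₁ i′ | eq = subst P eq (l i′)
  ... | inj₂ i′ | eq = subst P eq (r i′)

  -- The offset is `0#` on the first `t` coordinates, so undoing the product with `0#` there fixes
  -- the row; comparing that row with `w` on the other coordinates gives the offset.
  𝓡-covers : ∀ w → ∃ λ e → 𝓡 e w
  𝓡-covers w with balanced (_↑ˡ d) (↑ˡ-injective d _ _) (λ i → latin (w (i ↑ˡ d)) 0#)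
  ... | r , row , _ = e , r , ↑-cases left right
    where
    δ : Fin d → Fin u
    δ i = latin (rows r (t ↑ʳ i)) (w (t ↑ʳ i))
    e = funToFin δ
    left : ∀ i → latin (rows r (i ↑ˡ d)) (offset e (i ↑ˡ d)) ≡ w (i ↑ˡ d)
    left i rewrite offset-↑ˡ e i = sym (latin-solveˡ (sym (row i)))
    right : ∀ i → latin (rows r (t ↑ʳ i)) (offset e (t ↑ʳ i)) ≡ w (t ↑ʳ i)
    right i rewrite offset-↑ʳ e i | finToFun-funToFin δ i = latin-involutive _ _

  -- Both offsets are `0#` on the first `t` coordinates, so the two rows agree there and coincide;
  -- the remaining coordinates then recover the same offset.
  𝓡-disjoint : ∀ {e e′ w w′} → 𝓡 e w → 𝓡 e′ w′ → w ≗ w′ → e ≡ e′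
  𝓡-disjoint {e} {e′} {w} {w′} (r , row) (r′ , row′) w≗w′ =
    trans (sym (funToFin-finToFin {d} {u} e)) (trans (funToFin-cong same-offset) (funToFin-finToFin {d} {u} e′))
    where
    open ≡-Reasoning
    same-row : r ≡ r′
    same-row = row-unique (↑ˡ-injective d _ _) λ i → begin
      rows r (i ↑ˡ d)                         ≡⟨ latin-solveˡ (row (i ↑ˡ d)) ⟩
      latin (w (i ↑ˡ d)) (offset e (i ↑ˡ d))
        ≡⟨ cong₂ latin (w≗w′ _) (trans (offset-↑ˡ e i) (sym (offset-↑ˡ e′ i))) ⟩
      latin (w′ (i ↑ˡ d)) (offset e′ (i ↑ˡ d)) ≡⟨ latin-solveˡ (row′ (i ↑ˡ d)) ⟨
      rows r′ (i ↑ˡ d)                        ∎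
    same-offset : finToFun e ≗ finToFun e′
    same-offset i = begin
      finToFun e i                                ≡⟨ offset-↑ʳ e i ⟨
      offset e (t ↑ʳ i)                           ≡⟨ latin-solveʳ (row (t ↑ʳ i)) ⟩
      latin (rows r (t ↑ʳ i)) (w (t ↑ʳ i))        ≡⟨ cong₂ (λ s → latin (rows s (t ↑ʳ i))) same-row (w≗w′ _) ⟩
      latin (rows r′ (t ↑ʳ i)) (w′ (t ↑ʳ i))      ≡⟨ latin-solveʳ (row′ (t ↑ʳ i)) ⟨
      offset e′ (t ↑ʳ i)                          ≡⟨ offset-↑ʳ e′ i ⟩
      finToFun e′ i                               ∎
    funToFin-cong : ∀ {d} {f g : Fin d → Fin u} → f ≗ g → funToFin f ≡ funToFin g
    funToFin-cong {ℕ.zero}  f≗g = refl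
    funToFin-cong {ℕ.suc _} f≗g = cong₂ combine (f≗g zero) (funToFin-cong (f≗g ∘ suc))

  -- In each column the Latin product with a fixed offset permutes the symbols, so prescribing `z`
  -- on the translate amounts to prescribing the untranslated symbols on the original array.
  𝓡-balanced : ∀ e (c : Fin t → Fin (t + d)) → Injective _≡_ _≡_ c → (z : Vector (Fin u) t) →
               ∃! _≗_ λ w → 𝓡 e w × w ∘ c ≗ z
  𝓡-balanced e c c-inj z with balanced c c-inj (λ i → latin (z i) (offset e (c i)))
  ... | r , row , unique =
    (λ i → latin (rows r i) (offset e i)) ,
    ((r , λ _ → refl) , λ i → sym (latin-solveˡ (sym (row i)))) ,
    λ where ((r′ , row′) , w∘c≗z) i → trans
              (cong (λ s → latin (rows s i) (offset e i))
                    (unique λ j → latin-solveˡ (trans (row′ (c j)) (w∘c≗z j))))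
              (row′ i)

  𝓡-nonempty : ∀ e → Satisfiable (𝓡 e)
  𝓡-nonempty e with 𝓡-balanced e (_↑ˡ d) (↑ˡ-injective d _ _) (λ _ → 0#)
  ... | w , (w∈𝓡 , _) , _ = w , w∈𝓡

  largeSet : LargeSetOA t (t + d) u
  largeSet = record
    { M = u ^ d ; 𝓡 = 𝓡 ; nonempty = 𝓡-nonempty ; covers = 𝓡-covers
    ; disjoint = 𝓡-disjoint ; balanced = 𝓡-balanced }

OA⇒LargeSetOA : .{{_ : NonZero u}} → OrthogonalArray t k u → LargeSetOA t k u
OA⇒LargeSetOA {u} {t} {k} OA with t ≤? k
... | yes t≤k with d , refl ← m≤n⇒∃[o]m+o≡n t≤k = Translates.largeSet OA
-- An array of strength t > k satisfies no condition at all, so the single class of all words will do.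
... | no  t≰k = record
  { M = 1
  ; 𝓡 = λ _ _ → ⊤
  ; nonempty = λ _ → (λ _ → 0 mod u) , tt
  ; covers = λ _ → zero , tt
  ; disjoint = λ { {zero} {zero} _ _ _ → refl }
  ; balanced = λ _ _ c-inj → contradiction (injective⇒≤ c-inj) t≰k
  }

-- Finite subsets

-- The length `m` is kept apart from `∣ S ∣`, so that words along a block are indexed by `Fin k`
-- itself.
record Enumeration (S : Subset v) (m : ℕ) : Set where
  field
    element   : Fin m → Fin v
    injective : Injective _≡_ _≡_ element
    element∈  : ∀ i → element i ∈ S
    index     : ∀ {x} → x ∈ S → ∃ λ i → element i ≡ x

open Enumeration

enumerate-all : (S : Subset v) → Enumeration S ∣ S ∣
enumerate-all [] = record { element = λ () ; injective = λ { {()} } ; element∈ = λ () ; index = λ () }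
enumerate-all (outside ∷ S) = record
  { element   = suc ∘ element E
  ; injective = injective E ∘ suc-injective
  ; element∈  = there ∘ element∈ E
  ; index     = λ { (there x∈S) → let i , eq = index E x∈S in i , cong suc eq }
  }
  where E = enumerate-all S
enumerate-all (inside ∷ S) = record
  { element   = λ { zero → zero ; (suc i) → suc (element E i) }
  ; injective = λ { {zero} {zero} _ → refl ; {suc _} {suc _} eq → cong suc (injective E (suc-injective eq)) }
  ; element∈  = λ { zero → here ; (suc i) → there (element∈ E i) }
  ; index     = λ { here → zero , refl ; (there x∈S) → let i , eq = index E x∈S in suc i , cong suc eq }
  }
  where E = enumerate-all S

opaque
  enumerate : (S : Subset v) → ∣ S ∣ ≡ m → Enumeration S m
  enumerate S refl = enumerate-all S

module _ {S T : Subset v} (E : Enumeration S m) (F : Enumeration T k) (S⊆T : S ⊆ T) where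

  locate : Fin m → Fin k
  locate i = proj₁ (index F (S⊆T (element∈ E i)))

  element-locate : ∀ i → element F (locate i) ≡ element E i
  element-locate i = proj₂ (index F (S⊆T (element∈ E i)))

  locate-injective : Injective _≡_ _≡_ locate
  locate-injective {i} {j} eq = injective E
    (trans (sym (element-locate i)) (trans (cong (element F) eq) (element-locate j)))

-- Proofs of a size are equal, and a position in `T` is determined by the element found there. This
-- reconciles the enumerations of one block that arise from different proofs of membership.
locate-unique : {S T : Subset v} (E : Enumeration S m) (p q : ∣ T ∣ ≡ k) (S⊆T S⊆T′ : S ⊆ T) →
                locate E (enumerate T p) S⊆T ≗ locate E (enumerate T q) S⊆T′
locate-unique {T = T} E p q S⊆T S⊆T′ i with refl ← ≡-irrelevant p q = injective F
  (trans (element-locate E F S⊆T i) (sym (element-locate E F S⊆T′ i)))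
  where F = enumerate T p

opaque
  -- Locating each of two enumerations of `S` in the other gives injections both ways between
  -- `Fin m` and `Fin ∣ S ∣`.
  enumeration⇒size : {S : Subset v} → Enumeration S m → ∣ S ∣ ≡ m
  enumeration⇒size E = cantor-schröder-bernstein
    (locate-injective (enumerate-all _) E id) (locate-injective E (enumerate-all _) id)

opaque
  image : (Fin m → Fin v) → Subset v
  image f = tabulate λ x → does (any? λ i → f i ≟ x)

  image⁺ : (f : Fin m → Fin v) → ∀ i → f i ∈ image f
  image⁺ f i = lookup⇒[]= (f i) (image f)
    (trans (lookup∘tabulate _ (f i)) (dec-true (any? λ i′ → f i′ ≟ f i) (i , refl)))

  image⁻ : (f : Fin m → Fin v) → ∀ {x} → x ∈ image f → ∃ λ i → f i ≡ x
  image⁻ f {x} x∈ = from-does (any? λ i → f i ≟ x) (trans (sym (lookup∘tabulate _ x)) ([]=⇒lookup x∈))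
    where
    from-does : {A : Set} (A? : Dec A) → does A? ≡ true → A
    from-does (yes a) _ = a

enumerate-image : {f : Fin m → Fin v} → Injective _≡_ _≡_ f → Enumeration (image f) m
enumerate-image {f = f} f-inj = record
  { element = f ; injective = f-inj ; element∈ = image⁺ f ; index = image⁻ f }

-- Replacing every point by u copies

module Inflation (n g u : ℕ) where

  opaque
    -- A new point is a pair of an old point and a copy number; the cast only reassociates the
    -- product.
    point : Fin (n * g) → Fin u → Fin (n * (g * u))
    point x a = cast (*-assoc n g u) (combine x a)

    split : Fin (n * (g * u)) → Fin (n * g) × Fin u
    split y = remQuot u (cast (sym (*-assoc n g u)) y)

    point-split : ∀ y → uncurry point (split y) ≡ y
    point-split y = trans
      (cong (cast (*-assoc n g u)) (combine-remQuot {n * g} u (cast (sym (*-assoc n g u)) y)))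
      (cast-involutive (*-assoc n g u) (sym (*-assoc n g u)) y)

    split-point : ∀ x a → split (point x a) ≡ (x , a)
    split-point x a = trans
      (cong (remQuot {n * g} u) (cast-involutive (sym (*-assoc n g u)) (*-assoc n g u) (combine x a)))
      (remQuot-combine x a)

  base : Fin (n * (g * u)) → Fin (n * g)
  base = proj₁ ∘ split

  copy : Fin (n * (g * u)) → Fin u
  copy = proj₂ ∘ split

  base-point : ∀ x a → base (point x a) ≡ x
  base-point x a = cong proj₁ (split-point x a)

  copy-point : ∀ x a → copy (point x a) ≡ a
  copy-point x a = cong proj₂ (split-point x a)

  liftPoint : {S : Subset (n * g)} → Enumeration S m → Vector (Fin u) m → Fin m → Fin (n * (g * u))
  liftPoint E w i = point (element E i) (w i)

  -- The set with support `S` that takes, over the element at position `i`, the copy numbered `w i`.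
  lift : {S : Subset (n * g)} → Enumeration S m → Vector (Fin u) m → Subset (n * (g * u))
  lift E w = image (liftPoint E w)

  liftPoint-injective : {S : Subset (n * g)} (E : Enumeration S m) (w : Vector (Fin u) m) →
                        Injective _≡_ _≡_ (liftPoint E w)
  liftPoint-injective E w eq = injective E (trans (sym (base-point _ _)) (trans (cong base eq) (base-point _ _)))

  module _ {S : Subset (n * g)} (E : Enumeration S m) (w : Vector (Fin u) m) where

    lift⁺ : ∀ {i x a} → element E i ≡ x → w i ≡ a → point x a ∈ lift E w
    lift⁺ refl refl = image⁺ (liftPoint E w) _

    lift⁻ : ∀ {y} → y ∈ lift E w → ∃ λ i → element E i ≡ base y × w i ≡ copy y
    lift⁻ y∈ with i , refl ← image⁻ (liftPoint E w) y∈ = i , sym (base-point _ _) , sym (copy-point _ _)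

    lift-base : ∀ {y} → y ∈ lift E w → base y ∈ S
    lift-base y∈ with i , eq , _ ← lift⁻ y∈ = subst (_∈ S) eq (element∈ E i)

    lift-copy : ∀ {y i} → y ∈ lift E w → base y ≡ element E i → copy y ≡ w i
    lift-copy y∈ eq with i , eq₁ , eq₂ ← lift⁻ y∈ = trans (sym eq₂) (cong w (injective E (trans eq₁ eq)))

  module _ {S T : Subset (n * g)} (E : Enumeration S m) (F : Enumeration T k)
           {z : Vector (Fin u) m} {w : Vector (Fin u) k} where

    lift-⊆⁺ : (S⊆T : S ⊆ T) → w ∘ locate E F S⊆T ≗ z → lift E z ⊆ lift F w
    lift-⊆⁺ S⊆T eq {y} y∈ with i , refl ← image⁻ (liftPoint E z) y∈ =
      lift⁺ F w (element-locate E F S⊆T i) (eq i)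

    -- Over each element of `T` the larger lift contains a single copy, so the copy chosen by `z`
    -- must be the one chosen by `w`.
    lift-⊆⁻ : lift E z ⊆ lift F w → Σ[ S⊆T ∈ S ⊆ T ] w ∘ locate E F S⊆T ≗ z
    lift-⊆⁻ L⊆L = S⊆T , λ i → trans
      (sym (lift-copy F w (L⊆L (lift⁺ E z refl refl)) (trans (base-point _ _) (sym (element-locate E F S⊆T i)))))
      (copy-point _ _)
      where
      S⊆T : S ⊆ T
      S⊆T x∈S with i , refl ← index E x∈S =
        subst (_∈ T) (base-point _ _) (lift-base F w (L⊆L (lift⁺ E z refl refl)))

  -- Two size proofs are allowed because the same set may be known to have size `m` for different
  -- reasons, as a transversal or as a block.
  lift-cong : {S : Subset (n * g)} (p q : ∣ S ∣ ≡ m) {z w : Vector (Fin u) m} → z ≗ w →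
              lift (enumerate S p) z ≡ lift (enumerate S q) w
  lift-cong {m} {S} p q z≗w with refl ← ≡-irrelevant p q = ⊆-antisym (sub z≗w) (sub (sym ∘ z≗w))
    where
    E : Enumeration S m
    E = enumerate S p
    sub : ∀ {z w} → z ≗ w → lift E z ⊆ lift E w
    sub {z} {w} z≗w y∈ with i , refl ← image⁻ (liftPoint E z) y∈ = lift⁺ E w refl (sym (z≗w i))

  lift-support : {S T : Subset (n * g)} (E : Enumeration S m) (F : Enumeration T m) {z w : Vector (Fin u) m} →
                 lift E z ≡ lift F w → S ≡ T
  lift-support E F eq =
    ⊆-antisym (proj₁ (lift-⊆⁻ E F (subst (_ ∈_) eq))) (proj₁ (lift-⊆⁻ F E (subst (_ ∈_) (sym eq))))

  lift-unique : {S T : Subset (n * g)} (p : ∣ S ∣ ≡ m) (q : ∣ T ∣ ≡ m) {z w : Vector (Fin u) m} →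
                lift (enumerate S p) z ≡ lift (enumerate T q) w → S ≡ T × z ≗ w
  lift-unique {m} {S} {T} p q {z} {w} eq
    with refl ← lift-support (enumerate S p) (enumerate T q) eq
    with refl ← ≡-irrelevant p q = refl , λ i → trans
      (sym (copy-point _ _))
      (lift-copy E w (subst (point (element E i) (z i) ∈_) eq (lift⁺ E z refl refl)) (base-point _ _))
    where
    E : Enumeration S m
    E = enumerate S p

  -- The inflated groups and their transversals

  module Groups (G : Fin n → Subset (n * g)) (grouping : IsGrouping {n} {g} G) where
    open IsGrouping grouping
    open IsPartition partition

    members : ∀ j → Enumeration (G j) g
    members j = enumerate (G j) (groupSize j)

    -- Numbering the inflated group by `Fin (g * u)` makes its size a consequence of injectivity.
    G↑-points : ∀ j → Fin (g * u) → Fin (n * (g * u))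
    G↑-points j i = point (element (members j) (proj₁ (remQuot {g} u i))) (proj₂ (remQuot {g} u i))

    G↑ : Fin n → Subset (n * (g * u))
    G↑ j = image (G↑-points j)

    G↑⁺ : ∀ {j y} → base y ∈ G j → y ∈ G↑ j
    G↑⁺ {j} {y} b∈ with i , eq ← index (members j) b∈ = subst (_∈ G↑ j)
      (trans (cong₂ (λ x a → point (element (members j) x) a)
                    (cong proj₁ (remQuot-combine i (copy y))) (cong proj₂ (remQuot-combine i (copy y))))
             (trans (cong (λ x → point x (copy y)) eq) (point-split y)))
      (image⁺ (G↑-points j) (combine i (copy y)))

    G↑⁻ : ∀ {j y} → y ∈ G↑ j → base y ∈ G j
    G↑⁻ {j} y∈ with i , refl ← image⁻ (G↑-points j) y∈ =
      subst (_∈ G j) (sym (base-point _ _)) (element∈ (members j) _)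

    G↑-points-injective : ∀ j → Injective _≡_ _≡_ (G↑-points j)
    G↑-points-injective j {i} {i′} eq = begin
      i                                   ≡⟨ combine-remQuot {g} u i ⟨
      uncurry combine (remQuot {g} u i)   ≡⟨ cong₂ combine same-member same-copy ⟩
      uncurry combine (remQuot {g} u i′)  ≡⟨ combine-remQuot {g} u i′ ⟩
      i′                                  ∎
      where
      open ≡-Reasoning
      same-member : proj₁ (remQuot {g} u i) ≡ proj₁ (remQuot {g} u i′)
      same-member = injective (members j) (trans (sym (base-point _ _)) (trans (cong base eq) (base-point _ _)))
      same-copy : proj₂ (remQuot {g} u i) ≡ proj₂ (remQuot {g} u i′)
      same-copy = trans (sym (copy-point _ _)) (trans (cong copy eq) (copy-point _ _))

    grouping↑ : .{{_ : NonZero u}} → IsGrouping {n} {g * u} G↑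
    grouping↑ = record
      { partition = record
        { nonempty = λ j → let x , x∈ = nonempty j in
                           point x (0 mod u) , G↑⁺ (subst (_∈ G j) (sym (base-point _ _)) x∈)
        ; within   = λ _ _ → _
        ; disjoint = λ j≢j′ (y∈ , y∈′) → disjoint j≢j′ (G↑⁻ y∈ , G↑⁻ y∈′)
        ; covers   = λ _ → let j , b∈ = covers _ in j , G↑⁺ b∈
        }
      ; groupSize = λ j → enumeration⇒size (enumerate-image (G↑-points-injective j))
      }

    open IsTransversal

    lift-transversal : ∀ {S} (T : IsTransversal G m S) (w : Vector (Fin u) m) →
                       IsTransversal G↑ m (lift (enumerate S (size T)) w)
    lift-transversal {S = S} T w = record
      { size      = enumeration⇒size (enumerate-image (liftPoint-injective E w))
      ; atMostOne = λ j y∈ y∈G y′∈ y′∈G → same y∈ y′∈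
          (atMostOne T j (lift-base E w y∈) (G↑⁻ y∈G) (lift-base E w y′∈) (G↑⁻ y′∈G))
      }
      where
      E = enumerate S (size T)
      same : ∀ {y y′} → y ∈ lift E w → y′ ∈ lift E w → base y ≡ base y′ → y ≡ y′
      same {y} {y′} y∈ y′∈ eq with i , eqᵢ , wᵢ ← lift⁻ E w y′∈ =
        trans (sym (point-split y)) (trans
          (cong₂ point eq (trans (lift-copy E w y∈ (trans eq (sym eqᵢ))) wᵢ))
          (point-split y′))

    -- Two points of `S` over the same old point would share a new group, so `base` is injective on
    -- `S`. The support is its image, and the word records the copy lying over each element.
    transversal-is-lift : ∀ {S} → IsTransversal G↑ m S →
              ∃ λ R → Σ[ T ∈ IsTransversal G m R ] ∃ λ w → S ≡ lift (enumerate R (size T)) w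
    transversal-is-lift {m} {S} T = R , R-transversal , w , ⊆-antisym S⊆lift lift⊆S
      where
      E = enumerate S (size T)
      f : Fin m → Fin (n * g)
      f = base ∘ element E
      R = image f

      base-unique : ∀ {y y′} → y ∈ S → y′ ∈ S → base y ≡ base y′ → y ≡ y′
      base-unique {y} y∈ y′∈ eq with j , b∈ ← covers {base y} _ =
        atMostOne T j y∈ (G↑⁺ b∈) y′∈ (G↑⁺ (subst (_∈ G j) eq b∈))

      f-injective : Injective _≡_ _≡_ f
      f-injective eq = injective E (base-unique (element∈ E _) (element∈ E _) eq)

      R-transversal : IsTransversal G m R
      R-transversal = record
        { size = enumeration⇒size (enumerate-image f-injective)
        ; atMostOne = one
        }
        where
        one : ∀ j {x y} → x ∈ R → x ∈ G j → y ∈ R → y ∈ G j → x ≡ y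
        one j x∈R x∈G y∈R y∈G with a , refl ← image⁻ f x∈R | b , refl ← image⁻ f y∈R =
          cong base (atMostOne T j (element∈ E a) (G↑⁺ x∈G) (element∈ E b) (G↑⁺ y∈G))

      -- This enumeration is built from `R` alone and is not assumed to follow the order of `f`, so
      -- the point of `S` over each position is looked up anew.
      F = enumerate R (size R-transversal)

      above : ∀ i → ∃ λ y → y ∈ S × base y ≡ element F i
      above i with a , eq ← image⁻ f (element∈ F i) = element E a , element∈ E a , eq

      w : Vector (Fin u) m
      w i = copy (proj₁ (above i))

      point-above : ∀ i → point (element F i) (w i) ≡ proj₁ (above i)
      point-above i = trans (cong (λ x → point x (w i)) (sym (proj₂ (proj₂ (above i))))) (point-split _)

      lift⊆S : lift F w ⊆ S
      lift⊆S y∈ with i , refl ← image⁻ (liftPoint F w) y∈ =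
        subst (_∈ S) (sym (point-above i)) (proj₁ (proj₂ (above i)))

      S⊆lift : S ⊆ lift F w
      S⊆lift {y} y∈S with a , refl ← index E y∈S with i , eq ← index F (image⁺ f a) =
        subst (_∈ lift F w)
          (trans (point-above i)
                 (base-unique (proj₁ (proj₂ (above i))) y∈S (trans (proj₂ (proj₂ (above i))) eq)))
          (lift⁺ F w refl refl)

-- Combining the designs with the classes of words

theorem4 : (n g k t u : ℕ) →
    .{{_ : NonZero n}} .{{_ : NonZero g}} .{{_ : NonZero k}} .{{_ : NonZero t}} .{{_ : NonZero u}} →
    LargeSet n g k t → OrthogonalArray t k u → LargeSet n (g * u) k t
theorem4 n g k t u LH OA = record
  { G         = G↑
  ; grouping  = grouping↑
  ; N         = N * M
  ; 𝓑         = 𝓑↑ ∘ remQuot M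
  ; partition = record
    { nonempty = 𝓑↑-nonempty ∘ remQuot M
    ; within   = λ _ → 𝓑↑-transversal
    ; disjoint = λ j≢j′ (S∈ , S∈′) → j≢j′ (remQuot-injective (𝓑↑-disjoint S∈ S∈′))
    ; covers   = 𝓑↑-covers
    }
  ; designs   = λ j → record
    { grouping = grouping↑
    ; blocks   = 𝓑↑-transversal
    ; balanced = 𝓑↑-balanced (remQuot M j)
    }
  }
  where
  open LargeSet LH
  open LargeSetOA (OA⇒LargeSetOA OA) using (M; 𝓡) renaming
    (nonempty to 𝓡-nonempty; covers to 𝓡-covers; disjoint to 𝓡-disjoint; balanced to 𝓡-balanced)
  open IsPartition partition
  open IsTransversal
  open Inflation n g u
  open Groups G grouping

  block-transversal : ∀ {j B} → 𝓑 j B → IsTransversal G k B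
  block-transversal {j} = within j

  block-size : ∀ {j B} → 𝓑 j B → ∣ B ∣ ≡ k
  block-size = size ∘ block-transversal

  𝓑↑ : Fin N × Fin M → Pred (Subset (n * (g * u))) 0ℓ
  𝓑↑ (j , e) S = ∃₂ λ B w → Σ[ B∈ ∈ 𝓑 j B ] 𝓡 e w × S ≡ lift (enumerate B (block-size B∈)) w

  𝓑↑-nonempty : ∀ je → Satisfiable (𝓑↑ je)
  𝓑↑-nonempty (j , e) with B , B∈ ← nonempty j | w , w∈ ← 𝓡-nonempty e = _ , B , w , B∈ , w∈ , refl

  𝓑↑-transversal : ∀ {je S} → 𝓑↑ je S → IsTransversal G↑ k S
  𝓑↑-transversal (B , w , B∈ , _ , refl) = lift-transversal (block-transversal B∈) w

  𝓑↑-disjoint : ∀ {je je′ S} → 𝓑↑ je S → 𝓑↑ je′ S → je ≡ je′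
  𝓑↑-disjoint {j , e} {j′ , e′} (B , w , B∈ , w∈ , refl) (B′ , w′ , B′∈ , w′∈ , eq)
    with refl , w≗w′ ← lift-unique {S = B} {B′} (block-size B∈) (block-size B′∈) eq
    with refl ← 𝓡-disjoint w∈ w′∈ w≗w′
    -- Disjointness only excludes a common block for distinct indices, so equality of the indices is
    -- decided first.
    with j ≟ j′
  ... | yes refl = refl
  ... | no j≢j′  = contradiction (B∈ , B′∈) (disjoint j≢j′)

  𝓑↑-covers : ∀ {S} → IsTransversal G↑ k S → ∃ λ i → 𝓑↑ (remQuot M i) S
  𝓑↑-covers S∈ with B , B-transversal , w , refl ← transversal-is-lift S∈
    with j , B∈ ← covers B-transversal | e , w∈ ← 𝓡-covers w =
      combine j e , subst (λ je → 𝓑↑ je _) (sym (remQuot-combine j e))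
        (B , w , B∈ , w∈ , lift-cong {S = B} (size B-transversal) (block-size B∈) λ _ → refl)

  remQuot-injective : {i i′ : Fin (N * M)} → remQuot {N} M i ≡ remQuot M i′ → i ≡ i′
  remQuot-injective {i} {i′} eq =
    trans (sym (combine-remQuot {N} M i))
      (trans (cong (uncurry (combine {N} {M})) eq) (combine-remQuot {N} M i′))

  𝓑↑-balanced : ∀ je {S} → IsTransversal G↑ t S → ∃! _≡_ λ L → 𝓑↑ je L × S ⊆ L
  𝓑↑-balanced (j , e) S-transversal
    with T , T-transversal , z , refl ← transversal-is-lift S-transversal
    with B , (B∈ , T⊆B) , B-unique ← IsHDesign.balanced (designs j) T-transversal
    = lift F w , ((B , w , B∈ , w∈ , refl) , lift-⊆⁺ E F T⊆B w∘c≗z) , unique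
    where
    E = enumerate T (size T-transversal)
    F = enumerate B (block-size B∈)

    -- The columns are the positions in `B` of the elements of `T`; they are distinct, so the
    -- balance of the class `e` applies.
    interpolated : ∃! _≗_ λ w → 𝓡 e w × w ∘ locate E F T⊆B ≗ z
    interpolated = 𝓡-balanced e (locate E F T⊆B) (locate-injective E F T⊆B) z

    w = proj₁ interpolated
    w∈ = proj₁ (proj₁ (proj₂ interpolated))
    w∘c≗z = proj₂ (proj₁ (proj₂ interpolated))

    unique : ∀ {L} → 𝓑↑ (j , e) L × lift E z ⊆ L → lift F w ≡ L
    unique ((B′ , w′ , B′∈ , w′∈ , refl) , S⊆L)
      with T⊆B′ , w′∘c′≗z ← lift-⊆⁻ E (enumerate B′ (block-size B′∈)) S⊆L
      -- The support of any competing block contains `T`, hence is `B`. Only its word and its size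
      -- proof may still differ, and `lift-cong` absorbs both.
      with refl ← B-unique (B′∈ , T⊆B′)
      = lift-cong {S = B} p q (proj₂ (proj₂ interpolated)
          (w′∈ , λ i → trans (cong w′ (locate-unique {T = B} E p q T⊆B T⊆B′ i)) (w′∘c′≗z i)))
      where
      p : ∣ B ∣ ≡ k
      p = block-size B∈
      q : ∣ B ∣ ≡ k
      q = block-size B′∈
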